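{- Let $G$ be a $2$-free circular interval digraph on $n$ vertices. Then $\tilde{P}_3(G) \leq n^3/16$.
   Context: All digraphs are finite and simple: no loops $uu$ and no multiple edges. A digraph is $2$-free if it has no directed cycle of length at most $2$, i.e. there are no distinct vertices $u,v$ with both $uv$ and $vu$ edges. A digraph $G$ is a circular interval digraph if its vertices can be arranged in a circle such that for every triple $u,v,w$ of distinct vertices in clockwise order, if $uw\in E(G)$ then $uv,vw\in E(G)$. $\tilde{P}_3(G)$ denotes the number of induced $3$-vertex directed paths in $G$, i.e. the number of ordered triples $(u,w,v)$ of distinct vertices with $uw,wv\in E(G)$ and neither $uv$ nor $vu$ in $E(G)$. -}

module Defs where

open import Data.Nat using (ℕ; _+_; _<_)
open import Data.Bool using (Bool; true; false; _∧_; not)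
open import Data.Fin using (Fin; toℕ)
open import Data.Fin.Permutation using (Permutation′; _⟨$⟩ʳ_)
open import Data.List using (List; map; allFin)
open import Data.Nat.ListAction using (sum)
open import Data.Product using (_×_)
open import Data.Sum using (_⊎_)
open import Relation.Nullary using (¬_; Dec; yes; no)
open import Relation.Binary.PropositionalEquality using (_≡_; _≢_)
open import Data.Fin using (_≟_)

record Digraph (n : ℕ) : Set where
  field
    edge   : Fin n → Fin n → Bool
    noLoop : ∀ u → edge u u ≡ false
open Digraph public

_⇒[_]_ : ∀ {n} → Fin n → Digraph n → Fin n → Set
u ⇒[ G ] v = edge G u v ≡ true

TwoFree : ∀ {n} → Digraph n → Set
TwoFree {n} G = ∀ (u v : Fin n) → u ≢ v → ¬ (u ⇒[ G ] v × v ⇒[ G ] u)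

-- Positions a, b, c (distinct) occur in clockwise cyclic order around the
-- circle 0,1,…,n-1 (clockwise = increasing position, wrapping around).
ClockwiseOrder : ℕ → ℕ → ℕ → Set
ClockwiseOrder a b c = (a < b × b < c) ⊎ (b < c × c < a) ⊎ (c < a × a < b)

IsCircularIntervalArrangement : ∀ {n} → Digraph n → Permutation′ n → Set
IsCircularIntervalArrangement {n} G pos =
  ∀ (u v w : Fin n) → u ≢ v → v ≢ w → u ≢ w →
  ClockwiseOrder (toℕ (pos ⟨$⟩ʳ u)) (toℕ (pos ⟨$⟩ʳ v)) (toℕ (pos ⟨$⟩ʳ w)) →
  u ⇒[ G ] w → (u ⇒[ G ] v × v ⇒[ G ] w)

CircularInterval : ∀ {n} → Digraph n → Set
CircularInterval {n} G =
  Data.Product.Σ (Permutation′ n) (IsCircularIntervalArrangement G)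

eqb : ∀ {n} → Fin n → Fin n → Bool
eqb a b with a ≟ b
... | yes _ = true
... | no _ = false

isInducedP3 : ∀ {n} → Digraph n → Fin n → Fin n → Fin n → Bool
isInducedP3 G u w v =
  not (eqb u w) ∧ not (eqb w v) ∧ not (eqb u v) ∧
  edge G u w ∧ edge G w v ∧ not (edge G u v) ∧ not (edge G v u)

ind : Bool → ℕ
ind true = 1
ind false = 0

inducedP3Count : ∀ {n} → Digraph n → ℕ
inducedP3Count {n} G =
  sum (map (λ u → sum (map (λ w → sum (map (λ v → ind (isInducedP3 G u w v))
        (allFin n))) (allFin n))) (allFin n))

{-# OPTIONS --safe #-}
module Submission where

-- Write a and b for the in- and out-degree of a vertex, ℓ(u,w) for the clockwise distance.
-- An induced path is a 2-path that closes neither to a transitive nor to a cyclic triangle,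
-- so their number is Σ ab minus those of transitive and of cyclic triangles (the latter
-- counted once per edge).  For an edge uw there are ℓ(u,w) − 1 vertices v with
-- u → v → w, which gives Σ a(a−1)/2 = Σ b(b−1)/2 transitive triangles.  By 2-freeness the
-- out-neighbours of w and the in-neighbours of u all lie on the arc from w to u, so uw is in
-- at least b(w) + a(u) + ℓ(u,w) + 1 − n cyclic triangles.  This bound is summed only over
-- the edges of length greater than t = ⌊n/4⌋, the range where it is positive for the
-- extremal graph (all out-degrees ≈ 3n/8).  Since the edges at a vertex have lengths
-- 1, 2, …, everything becomes a sum over vertices of a function of a and b, and that
-- function is at most n²/16 at each vertex.

open import Defs
open import Data.Bool using (Bool; true; false; _∧_; not; T)
open import Data.Empty using (⊥-elim)
open import Data.Fin using (Fin; zero; suc; toℕ; fromℕ<; _≟_)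
open import Data.Fin.Permutation using (Permutation′; permutation; _⟨$⟩ʳ_; _⟨$⟩ˡ_; _∘ₚ_; inverseˡ; inverseʳ)
open import Data.Fin.Properties using (toℕ<n; toℕ-fromℕ<; toℕ-injective)
open import Data.List using (map; allFin; tabulate)
open import Data.List.Properties using (map-tabulate)
open import Data.Nat hiding (_≟_)
open import Data.Nat.DivMod using (m≡m%n+[m/n]*n; m%n<n)
open import Data.Nat.ListAction using () renaming (sum to sumᴸ)
open import Data.Nat.Properties hiding (_≟_)
open import Algebra.Properties.CommutativeMonoid.Sum +-0-commutativeMonoid using (sum-permute)
open import Algebra.Properties.Semiring.Sum +-*-semiring using (sum; sum-cong-≗; ∑-distrib-+; ∑-comm; *-distribˡ-sum; *-distribʳ-sum)
open import Data.Nat.Solver using (module +-*-Solver)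
open import Data.Nat.Tactic.RingSolver using (solve-∀)
open import Data.Product using (∃; _×_; _,_; proj₁; proj₂)
open import Data.Sum using (_⊎_; inj₁; inj₂)
open import Data.Unit using (tt)
open import Function using (_∘_)
open import Relation.Binary.PropositionalEquality
open import Relation.Nullary using (¬_; yes; no)

-- The inequality at a single vertex

-- Subtraction-free form of `b − a = (v − u) + k`: the hypothesis `eq` is then a polynomial
-- identity, which the ring solver can check.
≤-from-slack : ∀ {a b u v} k → u ≤ v → a + v + k ≡ b + u → a ≤ b
≤-from-slack {a} {b} {u} {v} k u≤v eq = +-cancelʳ-≤ u a b (begin
  a + u      ≤⟨ +-monoʳ-≤ a u≤v ⟩
  a + v      ≤⟨ m≤m+n (a + v) k ⟩
  a + v + k  ≡⟨ eq ⟩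
  b + u      ∎)
  where open ≤-Reasoning

difference : ∀ {m n} → m ≤ n → ∃ λ d → n ≡ m + d
difference {m} {n} m≤n = n ∸ m , sym (m+[n∸m]≡n m≤n)

2mn≤m²+n² : ∀ m n → 2 * (m * n) ≤ m * m + n * n
2mn≤m²+n² m n with ≤-total m n
... | inj₁ m≤n with difference m≤n
...   | d , refl = m+n≤o⇒m≤o _ (≤-reflexive (identity m d))
  where
  identity : ∀ m d → 2 * (m * (m + d)) + d * d ≡ m * m + (m + d) * (m + d)
  identity = solve-∀
2mn≤m²+n² m n | inj₂ n≤m with difference n≤m
...   | d , refl = m+n≤o⇒m≤o _ (≤-reflexive (identity n d))
  where
  identity : ∀ n d → 2 * ((n + d) * n) + d * d ≡ (n + d) * (n + d) + n * n
  identity = solve-∀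

-- (m − n)(m − n + 1) ≥ 0, as m − n is an integer.
2mn+n≤m²+m+n² : ∀ m n → 2 * (m * n) + n ≤ m * m + m + n * n
2mn+n≤m²+m+n² m n with <-≤-connex m n
... | inj₁ m<n with difference m<n
...   | d , refl = m+n≤o⇒m≤o _ (≤-reflexive (identity m d))
  where
  identity : ∀ m d → 2 * (m * (suc m + d)) + (suc m + d) + d * suc d
                   ≡ m * m + m + (suc m + d) * (suc m + d)
  identity = solve-∀
2mn+n≤m²+m+n² m n | inj₂ n≤m with difference n≤m
...   | d , refl = m+n≤o⇒m≤o _ (≤-reflexive (identity n d))
  where
  identity : ∀ n d → 2 * ((n + d) * n) + n + d * suc d
                   ≡ (n + d) * (n + d) + (n + d) + n * n
  identity = solve-∀

open +-*-Solver using (Polynomial; solve; con; _:+_; _:*_; _:=_)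

-- With x = a ∸ t and y = b ∸ t, a vertex of in-degree a and out-degree b contributes
-- (gain − loss) / 16 to the upper bound on the number of induced paths.
-- Generic in the operations, so that the ring solver can be given the same expressions.
module Expressions {A : Set} (_⊕_ _⊗_ : A → A → A) (κ : ℕ → A) where

  gainᴱ : A → A → A → A → A → A
  gainᴱ n a b x y = (κ 16 ⊗ (a ⊗ b)) ⊕ ((κ 8 ⊗ a) ⊕ ((κ 8 ⊗ b) ⊕
    (((κ 8 ⊗ n) ⊗ x) ⊕ ((κ 8 ⊗ n) ⊗ y))))

  lossᴱ : A → A → A → A → A → A
  lossᴱ t a b x y =
    (κ 4 ⊗ (a ⊗ (κ 1 ⊕ a))) ⊕ ((κ 4 ⊗ (b ⊗ (κ 1 ⊕ b))) ⊕
    ((κ 16 ⊗ (b ⊗ x)) ⊕ ((κ 16 ⊗ (a ⊗ y)) ⊕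
    ((κ 4 ⊗ (x ⊗ (κ 1 ⊕ (a ⊕ t)))) ⊕ ((κ 4 ⊗ (y ⊗ (κ 1 ⊕ (b ⊕ t)))) ⊕
    ((κ 8 ⊗ x) ⊕ (κ 8 ⊗ y)))))))

open Expressions _+_ _*_ (λ c → c) renaming (gainᴱ to gain; lossᴱ to loss)

module _ {k : ℕ} where
  open Expressions {Polynomial k} _:+_ _:*_ con public renaming (gainᴱ to gainᴾ; lossᴱ to lossᴾ)

-- With r = n − 4t and z = x + y − t the slack is 2(2z + 1 − r)² + 2 − (2 − r)², plus
-- 4c(2t + c + 1) where c = t − a is positive in gain≤loss-mixed.
gain≤loss-long : ∀ t r x y → r < 4 → let n = r + t * 4 in
  gain n (t + x) (t + y) x y ≤ n * n + loss t (t + x) (t + y) x y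
gain≤loss-long t 0 x y _ = ≤-from-slack 0 (*-monoʳ-≤ 8 (2mn+n≤m²+m+n² (x + y) t))
  (solve 3 (λ t x y → let n = con 0 :+ t :* con 4; p = x :+ y in
    gainᴾ n (t :+ x) (t :+ y) x y :+ con 8 :* (p :* p :+ p :+ t :* t) :+ con 0
      := n :* n :+ lossᴾ t (t :+ x) (t :+ y) x y :+ con 8 :* (con 2 :* (p :* t) :+ t)) refl t x y)
gain≤loss-long t 1 x y _ = ≤-from-slack 1 (*-monoʳ-≤ 8 (2mn≤m²+n² (x + y) t))
  (solve 3 (λ t x y → let n = con 1 :+ t :* con 4; p = x :+ y in
    gainᴾ n (t :+ x) (t :+ y) x y :+ con 8 :* (p :* p :+ t :* t) :+ con 1
      := n :* n :+ lossᴾ t (t :+ x) (t :+ y) x y :+ con 8 :* (con 2 :* (p :* t))) refl t x y)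
gain≤loss-long t 2 x y _ = ≤-from-slack 4 (*-monoʳ-≤ 8 (2mn+n≤m²+m+n² t (x + y)))
  (solve 3 (λ t x y → let n = con 2 :+ t :* con 4; p = x :+ y in
    gainᴾ n (t :+ x) (t :+ y) x y :+ con 8 :* (t :* t :+ t :+ p :* p) :+ con 4
      := n :* n :+ lossᴾ t (t :+ x) (t :+ y) x y :+ con 8 :* (con 2 :* (t :* p) :+ p)) refl t x y)
gain≤loss-long t 3 x y _ = ≤-from-slack 1 (*-monoʳ-≤ 8 (2mn≤m²+n² (x + y) (suc t)))
  (solve 3 (λ t x y → let n = con 3 :+ t :* con 4; p = x :+ y in
    gainᴾ n (t :+ x) (t :+ y) x y :+ con 8 :* (p :* p :+ (con 1 :+ t) :* (con 1 :+ t)) :+ con 1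
      := n :* n :+ lossᴾ t (t :+ x) (t :+ y) x y :+ con 8 :* (con 2 :* (p :* (con 1 :+ t)))) refl t x y)
gain≤loss-long t (suc (suc (suc (suc _)))) x y (s≤s (s≤s (s≤s (s≤s ()))))

gain≤loss-mixed : ∀ a c r y → r < 4 → let t = a + c; n = r + t * 4 in
  gain n a (t + y) 0 y ≤ n * n + loss t a (t + y) 0 y
gain≤loss-mixed a c r y r<4 =
  -- Compares with in-degree exactly `t`, the case `x = 0` of `gain≤loss-long`: lowering it by `c`
  -- increases the slack by the first argument.
  ≤-from-slack (4 * (c * (2 * (a + c) + suc c))) (gain≤loss-long (a + c) r 0 y r<4)
  (solve 4 (λ a c r y → let t = a :+ c; n = r :+ t :* con 4 in
    gainᴾ n a (t :+ y) (con 0) y :+ (n :* n :+ lossᴾ t (t :+ con 0) (t :+ y) (con 0) y)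
      :+ con 4 :* (c :* (con 2 :* t :+ (con 1 :+ c)))
      := n :* n :+ lossᴾ t a (t :+ y) (con 0) y :+ gainᴾ n (t :+ con 0) (t :+ y) (con 0) y) refl a c r y)

-- With no long edges only the transitive triangles help. One half of `16ab` is at most
-- `4(a² + b²)`, which they pay for; the other half and half of `8(a + b)` are at most
-- `8t² + 8t ≤ 16t² ≤ n²`.
gain≤loss-short : ∀ n t a b → t * 4 ≤ n → a ≤ t → b ≤ t →
  gain n a b 0 0 ≤ n * n + loss t a b 0 0
gain≤loss-short n t a b 4t≤n a≤t b≤t = begin
  gain n a b 0 0
    ≡⟨ identity₁ n a b ⟩
  4 * (2 * (a * b)) + (8 * (a * b) + 4 * (a + b)) + 4 * (a + b)
    ≤⟨ +-monoˡ-≤ (4 * (a + b)) (+-mono-≤ (*-monoʳ-≤ 4 (2mn≤m²+n² a b))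
         (+-mono-≤ (*-monoʳ-≤ 8 (*-mono-≤ a≤t b≤t)) (*-monoʳ-≤ 4 (+-mono-≤ a≤t b≤t)))) ⟩
  4 * (a * a + b * b) + (8 * (t * t) + 4 * (t + t)) + 4 * (a + b)
    ≤⟨ +-monoˡ-≤ (4 * (a + b)) (+-monoʳ-≤ (4 * (a * a + b * b)) bound) ⟩
  4 * (a * a + b * b) + n * n + 4 * (a + b)
    ≡⟨ identity₂ n t a b ⟩
  n * n + loss t a b 0 0 ∎
  where
  open ≤-Reasoning
  identity₁ : ∀ n a b → gain n a b 0 0 ≡
    4 * (2 * (a * b)) + (8 * (a * b) + 4 * (a + b)) + 4 * (a + b)
  identity₁ = solve 3 (λ n a b → gainᴾ n a b (con 0) (con 0) :=
    con 4 :* (con 2 :* (a :* b)) :+ (con 8 :* (a :* b) :+ con 4 :* (a :+ b)) :+ con 4 :* (a :+ b)) refl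
  identity₂ : ∀ n t a b → 4 * (a * a + b * b) + n * n + 4 * (a + b) ≡ n * n + loss t a b 0 0
  identity₂ = solve 4 (λ n t a b →
    con 4 :* (a :* a :+ b :* b) :+ n :* n :+ con 4 :* (a :+ b) := n :* n :+ lossᴾ t a b (con 0) (con 0)) refl
  m≤m² : ∀ m → m ≤ m * m
  m≤m² 0       = ≤-refl
  m≤m² (suc m) = m≤m+n (suc m) (m * suc m)
  identity₃ : ∀ t → 8 * (t * t) + 8 * (t * t) ≡ t * 4 * (t * 4)
  identity₃ = solve-∀
  identity₄ : ∀ t → 4 * (t + t) ≡ 8 * t
  identity₄ = solve-∀
  bound : 8 * (t * t) + 4 * (t + t) ≤ n * n
  bound = begin
    8 * (t * t) + 4 * (t + t)      ≡⟨ cong (8 * (t * t) +_) (identity₄ t) ⟩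
    8 * (t * t) + 8 * t            ≤⟨ +-monoʳ-≤ (8 * (t * t)) (*-monoʳ-≤ 8 (m≤m² t)) ⟩
    8 * (t * t) + 8 * (t * t)      ≡⟨ identity₃ t ⟩
    t * 4 * (t * 4)                ≤⟨ *-mono-≤ 4t≤n 4t≤n ⟩
    n * n                          ∎

gain-sym : ∀ n a b x y → gain n a b x y ≡ gain n b a y x
gain-sym = solve 5 (λ n a b x y → gainᴾ n a b x y := gainᴾ n b a y x) refl

loss-sym : ∀ t a b x y → loss t a b x y ≡ loss t b a y x
loss-sym = solve 5 (λ t a b x y → lossᴾ t a b x y := lossᴾ t b a y x) refl

-- The truncated `a ∸ t` and `b ∸ t` are the numbers of in- and out-edges longer than `t`, since the
-- lengths at a vertex are 1, ..., `a` and 1, ..., `b`.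
Bounded : ℕ → ℕ → ℕ → ℕ → Set
Bounded n t a b = gain n a b (a ∸ t) (b ∸ t) ≤ n * n + loss t a b (a ∸ t) (b ∸ t)

Bounded-sym : ∀ n t a b → Bounded n t a b → Bounded n t b a
Bounded-sym n t a b = subst₂ _≤_ (gain-sym n a b _ _) (cong (n * n +_) (loss-sym t a b _ _))

bounded-long : ∀ t r a b → r < 4 → t ≤ a → t ≤ b → Bounded (r + t * 4) t a b
bounded-long t r a b r<4 t≤a t≤b with difference t≤a | difference t≤b
... | x , refl | y , refl rewrite m+n∸m≡n t x | m+n∸m≡n t y = gain≤loss-long t r x y r<4

bounded-mixed : ∀ t r a b → r < 4 → a ≤ t → t ≤ b → Bounded (r + t * 4) t a b
bounded-mixed t r a b r<4 a≤t t≤b with difference a≤t | difference t≤b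
... | c , refl | y , refl rewrite m≤n⇒m∸n≡0 a≤t | m+n∸m≡n (a + c) y =
  gain≤loss-mixed a c r y r<4

bounded : ∀ t r a b → r < 4 → Bounded (r + t * 4) t a b
bounded t r a b r<4 with ≤-total a t | ≤-total b t
... | inj₂ t≤a | inj₂ t≤b = bounded-long t r a b r<4 t≤a t≤b
... | inj₁ a≤t | inj₂ t≤b = bounded-mixed t r a b r<4 a≤t t≤b
... | inj₂ t≤a | inj₁ b≤t =
  Bounded-sym (r + t * 4) t b a (bounded-mixed t r b a r<4 b≤t t≤a)
... | inj₁ a≤t | inj₁ b≤t rewrite m≤n⇒m∸n≡0 a≤t | m≤n⇒m∸n≡0 b≤t =
  gain≤loss-short _ t a b (m≤n+m (t * 4) r) a≤t b≤t

gain≤loss : ∀ n a b → Bounded n (n / 4) a b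
gain≤loss n a b = subst (λ m → Bounded m (n / 4) a b) (sym (m≡m%n+[m/n]*n n 4))
  (bounded (n / 4) (n % 4) a b (m%n<n n 4))

-- Sums

∑ : ∀ {n} → (Fin n → ℕ) → ℕ
∑ = sum

sum-map-allFin : ∀ n (f : Fin n → ℕ) → sumᴸ (map f (allFin n)) ≡ ∑ f
sum-map-allFin n f = trans (cong sumᴸ (map-tabulate (λ i → i) f)) (sum-tabulate n f)
  where
  sum-tabulate : ∀ n (f : Fin n → ℕ) → sumᴸ (tabulate f) ≡ ∑ f
  sum-tabulate zero    f = refl
  sum-tabulate (suc n) f = cong (f zero +_) (sum-tabulate n (f ∘ suc))

∑-mono : ∀ {n} {f g : Fin n → ℕ} → (∀ i → f i ≤ g i) → ∑ f ≤ ∑ g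
∑-mono {zero}  f≤g = z≤n
∑-mono {suc n} f≤g = +-mono-≤ (f≤g zero) (∑-mono (f≤g ∘ suc))

∑-const : ∀ n c → ∑ {n} (λ _ → c) ≡ n * c
∑-const zero    c = refl
∑-const (suc n) c = cong (c +_) (∑-const n c)

∑-zero : ∀ {n} {f : Fin n → ℕ} → (∀ i → f i ≡ 0) → ∑ f ≡ 0
∑-zero {n} f≡0 = trans (sum-cong-≗ f≡0) (trans (∑-const n 0) (*-zeroʳ n))

-- A downward closed predicate holds exactly on the first k indices, k being the number of indices
-- where it holds.
∑-initial : ∀ {n} (p : Fin n → Bool) (g : ℕ → ℕ) →
  (∀ i j → toℕ i < toℕ j → p j ≡ true → p i ≡ true) →
  ∑ (λ i → ind (p i) * g (toℕ i)) ≡ ∑ {∑ (ind ∘ p)} (g ∘ toℕ)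
∑-initial {zero}  p g closed = refl
∑-initial {suc n} p g closed with p zero in p0
... | true  = cong₂ _+_ (*-identityˡ (g 0))
                (∑-initial (p ∘ suc) (g ∘ suc) (λ i j i<j → closed (suc i) (suc j) (s≤s i<j)))
... | false = trans (∑-zero (λ i → cong (λ b → ind b * g (suc (toℕ i))) (none i)))
                (cong (λ k → ∑ {k} (g ∘ toℕ)) (sym (∑-zero (λ i → cong ind (none i)))))
  where
  none : ∀ i → p (suc i) ≡ false
  none i with p (suc i) in pi
  ... | false = refl
  ... | true  = trans (sym (closed zero (suc i) z<s pi)) p0

-- Meant for `p` a neighbourhood and `π` the distance from or to its centre. The centre, at distance
-- 0, is not its own neighbour, so the segment starts at 1; hence the `suc` on the right.
∑-initial-permuted : ∀ {n} (π : Permutation′ n) (p : Fin n → Bool) (g : ℕ → ℕ) →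
  (∀ v → toℕ (π ⟨$⟩ʳ v) ≡ 0 → p v ≡ false) →
  (∀ v w → 0 < toℕ (π ⟨$⟩ʳ v) → toℕ (π ⟨$⟩ʳ v) < toℕ (π ⟨$⟩ʳ w) → p w ≡ true → p v ≡ true) →
  ∑ (λ v → ind (p v) * g (toℕ (π ⟨$⟩ʳ v))) ≡ ∑ {∑ (ind ∘ p)} (g ∘ suc ∘ toℕ)
∑-initial-permuted {zero}  π p g p0 closed = refl
∑-initial-permuted {suc n} π p g p0 closed = begin
  ∑ (λ v → ind (p v) * g (toℕ (π ⟨$⟩ʳ v)))
    ≡⟨ sum-cong-≗ (λ v → cong (λ w → ind (p w) * g (toℕ (π ⟨$⟩ʳ v))) (sym (inverseˡ π {v}))) ⟩
  ∑ (λ v → f (π ⟨$⟩ʳ v))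
    ≡⟨ sum-permute f π ⟨
  ∑ f
    ≡⟨ cong (λ b → ind b * g 0 + ∑ (f ∘ suc)) q0 ⟩
  ∑ (f ∘ suc)
    ≡⟨ ∑-initial (q ∘ suc) (g ∘ suc) (λ i j i<j → closed _ _
         (subst (0 <_) (cong toℕ (sym (inverseʳ π))) z<s)
         (subst₂ _<_ (cong toℕ (sym (inverseʳ π))) (cong toℕ (sym (inverseʳ π))) (s≤s i<j))) ⟩
  ∑ {∑ (ind ∘ q ∘ suc)} (g ∘ suc ∘ toℕ)
    ≡⟨ cong (λ k → ∑ {k} (g ∘ suc ∘ toℕ)) count ⟩
  ∑ {∑ (ind ∘ p)} (g ∘ suc ∘ toℕ) ∎
  where
  open ≡-Reasoning
  q : Fin (suc n) → Bool
  q i = p (π ⟨$⟩ˡ i)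
  f : Fin (suc n) → ℕ
  f i = ind (q i) * g (toℕ i)
  q0 : q zero ≡ false
  q0 = p0 _ (cong toℕ (inverseʳ π))
  count : ∑ (ind ∘ q ∘ suc) ≡ ∑ (ind ∘ p)
  count = begin
    ∑ (ind ∘ q ∘ suc)                    ≡⟨ cong (λ b → ind b + ∑ (ind ∘ q ∘ suc)) q0 ⟨
    ∑ (ind ∘ q)                          ≡⟨ sum-permute (ind ∘ q) π ⟩
    ∑ (λ v → ind (p (π ⟨$⟩ˡ (π ⟨$⟩ʳ v))))  ≡⟨ sum-cong-≗ (λ v → cong (ind ∘ p) (inverseˡ π {v})) ⟩
    ∑ (ind ∘ p)                          ∎

∑-above : ∀ t b → ∑ {b} (λ k → ind (t <ᵇ suc (toℕ k))) ≡ b ∸ t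
∑-above t       zero    = sym (0∸n≡0 t)
∑-above zero    (suc b) = cong suc (trans (∑-const b 1) (*-identityʳ b))
∑-above (suc t) (suc b) = ∑-above t b

-- An arithmetic series, doubled to avoid division. The offset `c` makes the induction work:
-- removing the first index lengthens all remaining summands by one, and `c` absorbs this.
∑-above-weighted : ∀ t b c → 2 * ∑ {b} (λ k → ind (t <ᵇ suc (toℕ k)) * (suc (toℕ k) + c))
  ≡ (b ∸ t) * (suc (b + t) + 2 * c)
∑-above-weighted t       zero    c rewrite 0∸n≡0 t = refl
∑-above-weighted zero    (suc b) c = begin
  2 * (1 * suc c + ∑ {b} (λ k → 1 * (suc (suc (toℕ k)) + c)))
    ≡⟨ cong (λ s → 2 * (1 * suc c + s)) (sum-cong-≗ {b} (λ k → cong (1 *_) (sym (+-suc (suc (toℕ k)) c)))) ⟩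
  2 * (1 * suc c + s)
    ≡⟨ *-distribˡ-+ 2 (1 * suc c) s ⟩
  2 * (1 * suc c) + 2 * s
    ≡⟨ cong (2 * (1 * suc c) +_) (∑-above-weighted zero b (suc c)) ⟩
  2 * (1 * suc c) + b * (suc (b + 0) + 2 * suc c)
    ≡⟨ identity b c ⟩
  suc b * (suc (suc b + 0) + 2 * c) ∎
  where
  open ≡-Reasoning
  s = ∑ {b} (λ k → 1 * (suc (toℕ k) + suc c))
  identity : ∀ b c → 2 * (1 * suc c) + b * (suc (b + 0) + 2 * suc c) ≡ suc b * (suc (suc b + 0) + 2 * c)
  identity = solve-∀
∑-above-weighted (suc t) (suc b) c = begin
  2 * ∑ {b} (λ k → ind (t <ᵇ suc (toℕ k)) * (suc (suc (toℕ k)) + c))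
    ≡⟨ cong (2 *_) (sum-cong-≗ {b} (λ k → cong (ind (t <ᵇ suc (toℕ k)) *_) (sym (+-suc (suc (toℕ k)) c)))) ⟩
  2 * ∑ {b} (λ k → ind (t <ᵇ suc (toℕ k)) * (suc (toℕ k) + suc c))
    ≡⟨ ∑-above-weighted t b (suc c) ⟩
  (b ∸ t) * (suc (b + t) + 2 * suc c)
    ≡⟨ cong ((b ∸ t) *_) (identity b t c) ⟩
  (b ∸ t) * (suc (suc b + suc t) + 2 * c) ∎
  where
  open ≡-Reasoning
  identity : ∀ b t c → suc (b + t) + 2 * suc c ≡ suc (suc b + suc t) + 2 * c
  identity = solve-∀

∑-permuted : ∀ {n} (π : Permutation′ n) (f : Fin n → ℕ) → ∑ (λ v → f (π ⟨$⟩ʳ v)) ≡ ∑ f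
∑-permuted π f = sym (sum-permute f π)

∑-below : ∀ {n} m → m ≤ n → ∑ {n} (λ i → ind (toℕ i <ᵇ m)) ≡ m
∑-below {n}     zero    m≤n       = ∑-zero {n} (λ _ → refl)
∑-below {suc n} (suc m) (s≤s m≤n) = cong suc (∑-below m m≤n)

-- Will count the vertices strictly inside an arc of length `m`. Equality holds for positive `m`;
-- the inequality also covers `m = 0`.
∑-strictly-between : ∀ {n} m → m ≤ n → m ≤ suc (∑ {n} (λ i → ind (0 <ᵇ toℕ i) * ind (toℕ i <ᵇ m)))
∑-strictly-between         zero    _         = z≤n
∑-strictly-between {suc n} (suc m) (s≤s m≤n) = s≤s (≤-reflexive (trans (sym (∑-below m m≤n))
  (sum-cong-≗ {n} (λ i → sym (*-identityˡ (ind (toℕ i <ᵇ m)))))))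

∑-above-lengths : ∀ t b → 2 * ∑ {b} (λ k → ind (t <ᵇ suc (toℕ k)) * suc (toℕ k))
  ≡ (b ∸ t) * suc (b + t)
∑-above-lengths t b = begin
  2 * ∑ {b} (λ k → ind (t <ᵇ suc (toℕ k)) * suc (toℕ k))
    ≡⟨ cong (2 *_) (sum-cong-≗ {b} (λ k → cong (ind (t <ᵇ suc (toℕ k)) *_) (sym (+-identityʳ _)))) ⟩
  2 * ∑ {b} (λ k → ind (t <ᵇ suc (toℕ k)) * (suc (toℕ k) + 0))
    ≡⟨ ∑-above-weighted t b 0 ⟩
  (b ∸ t) * (suc (b + t) + 0)
    ≡⟨ cong ((b ∸ t) *_) (+-identityʳ _) ⟩
  (b ∸ t) * suc (b + t) ∎
  where open ≡-Reasoning

-- Distances on a circle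

-- d steps clockwise from x lead to y.
Step : ∀ {n} → Fin n → Fin n → Fin n → Set
Step {n} x d y = toℕ x + toℕ d ≡ toℕ y ⊎ toℕ x + toℕ d ≡ toℕ y + n

wraps : ∀ {n} {x d y : Fin n} → toℕ x + toℕ d ≡ toℕ y + n → toℕ y < toℕ x
wraps {n} {x} {d} {y} eq = +-cancelʳ-< n (toℕ y) (toℕ x)
  (subst (_< toℕ x + n) eq (+-monoʳ-< (toℕ x) (toℕ<n d)))

Step-sym : ∀ {n} {x d y : Fin n} → Step x d y → Step d x y
Step-sym {x = x} {d} (inj₁ eq) = inj₁ (trans (+-comm (toℕ d) (toℕ x)) eq)
Step-sym {x = x} {d} (inj₂ eq) = inj₂ (trans (+-comm (toℕ d) (toℕ x)) eq)

Step-uniqueʳ : ∀ {n} {x d y y′ : Fin n} → Step x d y → Step x d y′ → y ≡ y′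
Step-uniqueʳ (inj₁ p) (inj₁ q) = toℕ-injective (trans (sym p) q)
Step-uniqueʳ {n} {y = y} {y′} (inj₁ p) (inj₂ q) =
  ⊥-elim (<⇒≱ (toℕ<n y) (≤-trans (m≤n+m n (toℕ y′)) (≤-reflexive (trans (sym q) p))))
Step-uniqueʳ {n} {y = y} {y′} (inj₂ p) (inj₁ q) =
  ⊥-elim (<⇒≱ (toℕ<n y′) (≤-trans (m≤n+m n (toℕ y)) (≤-reflexive (trans (sym p) q))))
Step-uniqueʳ {n} (inj₂ p) (inj₂ q) = toℕ-injective (+-cancelʳ-≡ n _ _ (trans (sym p) q))

Step-uniqueᵐ : ∀ {n} {x d d′ y : Fin n} → Step x d y → Step x d′ y → d ≡ d′
Step-uniqueᵐ {x = x} (inj₁ p) (inj₁ q) = toℕ-injective (+-cancelˡ-≡ (toℕ x) _ _ (trans p (sym q)))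
Step-uniqueᵐ {x = x} (inj₂ p) (inj₂ q) = toℕ-injective (+-cancelˡ-≡ (toℕ x) _ _ (trans p (sym q)))
Step-uniqueᵐ {x = x} {d} {d′} (inj₁ p) (inj₂ q) =
  ⊥-elim (<⇒≱ (wraps {d = d′} q) (≤-trans (m≤m+n (toℕ x) (toℕ d)) (≤-reflexive p)))
Step-uniqueᵐ {x = x} {d} {d′} (inj₂ p) (inj₁ q) =
  ⊥-elim (<⇒≱ (wraps {d = d} p) (≤-trans (m≤m+n (toℕ x) (toℕ d′)) (≤-reflexive q)))

advance : ∀ {n} (x d : Fin n) → ∃ (Step x d)
advance {n} x d with <-≤-connex (toℕ x + toℕ d) n
... | inj₁ s<n = fromℕ< s<n , inj₁ (sym (toℕ-fromℕ< s<n))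
... | inj₂ n≤s = fromℕ< s∸n<n , inj₂ (begin
    toℕ x + toℕ d             ≡⟨ m∸n+n≡m n≤s ⟨
    toℕ x + toℕ d ∸ n + n     ≡⟨ cong (_+ n) (toℕ-fromℕ< s∸n<n) ⟨
    toℕ (fromℕ< s∸n<n) + n    ∎)
  where
  open ≡-Reasoning
  s∸n<n : toℕ x + toℕ d ∸ n < n
  s∸n<n = +-cancelʳ-< n _ n (subst (_< n + n) (sym (m∸n+n≡m n≤s)) (+-mono-< (toℕ<n x) (toℕ<n d)))

distance : ∀ {n} (x y : Fin n) → ∃ λ d → Step x d y
distance {n} x y with <-≤-connex (toℕ y) (toℕ x)
... | inj₂ x≤y = fromℕ< d<n , inj₁ (trans (cong (toℕ x +_) (toℕ-fromℕ< d<n)) (m+[n∸m]≡n x≤y))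
  where
  d<n : toℕ y ∸ toℕ x < n
  d<n = ≤-<-trans (m∸n≤m (toℕ y) (toℕ x)) (toℕ<n y)
... | inj₁ y<x = fromℕ< d<n , inj₂ (trans (cong (toℕ x +_) (toℕ-fromℕ< d<n)) (m+[n∸m]≡n x≤y+n))
  where
  x≤y+n : toℕ x ≤ toℕ y + n
  x≤y+n = ≤-trans (<⇒≤ (toℕ<n x)) (m≤n+m n (toℕ y))
  d<n : toℕ y + n ∸ toℕ x < n
  d<n = +-cancelˡ-< (toℕ x) _ n (subst (_< toℕ x + n) (sym (m+[n∸m]≡n x≤y+n)) (+-monoˡ-< n y<x))

dist : ∀ {n} → Fin n → Fin n → Fin n
dist x y = proj₁ (distance x y)

dist-step : ∀ {n} (x y : Fin n) → Step x (dist x y) y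
dist-step x y = proj₂ (distance x y)

-- As a permutation, the distance from a fixed point can reindex sums over vertices.
distances-from : ∀ {n} → Fin n → Permutation′ n
distances-from x = permutation (dist x) (λ d → proj₁ (advance x d))
  (λ d → Step-uniqueᵐ {x = x} (dist-step x _) (proj₂ (advance x d)))
  (λ y → Step-uniqueʳ {x = x} {d = dist x y} (proj₂ (advance x _)) (dist-step x y))

-- The relation `x + d = y` modulo `n` is symmetric in `x` and `d`, so for fixed `y` the map from
-- `x` to `d` is its own inverse.
distances-to : ∀ {n} → Fin n → Permutation′ n
distances-to y = permutation (λ x → dist x y) (λ x → dist x y) involutive involutive
  where
  involutive : ∀ x → dist (dist x y) y ≡ x
  involutive x = Step-uniqueᵐ {x = dist x y} (dist-step (dist x y) y) (Step-sym {x = x} (dist-step x y))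

dist≡0⇒≡ : ∀ {n} (x y : Fin n) → toℕ (dist x y) ≡ 0 → x ≡ y
dist≡0⇒≡ x y d≡0 with dist-step x y
... | inj₁ eq = toℕ-injective (trans (sym (+-identityʳ _)) (trans (cong (toℕ x +_) (sym d≡0)) eq))
... | inj₂ eq = ⊥-elim (<⇒≱ (toℕ<n x) (≤-trans (m≤n+m _ (toℕ y))
  (≤-reflexive (trans (sym eq) (trans (cong (toℕ x +_) d≡0) (+-identityʳ _))))))

dist-refl : ∀ {n} (x : Fin n) → toℕ (dist x x) ≡ 0
dist-refl x with dist-step x x
... | inj₁ eq = +-cancelˡ-≡ (toℕ x) _ 0 (trans eq (sym (+-identityʳ _)))
... | inj₂ eq = ⊥-elim (<-irrefl refl (wraps {x = x} {dist x x} {x} eq))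

module _ {n} {x y z : Fin n} where

  -- Going clockwise from `x`, one meets `y` before `z`. The three disjuncts of `ClockwiseOrder`
  -- tell whether position 0 is passed after `z`, between `y` and `z`, or before `y`; passing it on
  -- the way to `y` but not to `z` is impossible.
  dist-order-from : 0 < toℕ (dist x y) → toℕ (dist x y) < toℕ (dist x z) →
    ClockwiseOrder (toℕ x) (toℕ y) (toℕ z)
  dist-order-from 0<d d<d′ with dist-step x y | dist-step x z
  ... | inj₁ p | inj₁ q = inj₁ (subst (toℕ x <_) p (m<m+n (toℕ x) 0<d) ,
                                subst₂ _<_ p q (+-monoʳ-< (toℕ x) d<d′))
  ... | inj₁ p | inj₂ q = inj₂ (inj₂ (wraps {d = dist x z} q , subst (toℕ x <_) p (m<m+n (toℕ x) 0<d)))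
  ... | inj₂ p | inj₁ q = ⊥-elim (<⇒≱ (toℕ<n z) (≤-trans (m≤n+m n (toℕ y))
                            (<⇒≤ (subst₂ _<_ p q (+-monoʳ-< (toℕ x) d<d′)))))
  ... | inj₂ p | inj₂ q = inj₂ (inj₁ (+-cancelʳ-< n _ _ (subst₂ _<_ p q (+-monoʳ-< (toℕ x) d<d′)) ,
                                wraps {d = dist x z} q))

  dist-order-to : 0 < toℕ (dist y z) → toℕ (dist y z) < toℕ (dist x z) →
    ClockwiseOrder (toℕ x) (toℕ y) (toℕ z)
  dist-order-to 0<d d<d′ with dist-step y z | dist-step x z
  ... | inj₁ p | inj₁ q = inj₁ (x<y (trans q (sym p)) , subst (toℕ y <_) p (m<m+n (toℕ y) 0<d))
    where
    x<y : toℕ x + toℕ (dist x z) ≡ toℕ y + toℕ (dist y z) → toℕ x < toℕ y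
    x<y eq = +-cancelʳ-< (toℕ (dist y z)) _ _
      (subst (toℕ x + toℕ (dist y z) <_) eq (+-monoʳ-< (toℕ x) d<d′))
  ... | inj₁ p | inj₂ q = inj₂ (inj₁ (subst (toℕ y <_) p (m<m+n (toℕ y) 0<d) , wraps {d = dist x z} q))
  -- Impossible: `q` gives `dist y z < dist x z ≤ z`, so `y + dist y z = z + n` would force `y ≥ n`.
  ... | inj₂ p | inj₁ q = ⊥-elim (<⇒≱ (toℕ<n y) (+-cancelʳ-≤ (toℕ (dist y z)) n (toℕ y)
      (≤-trans (+-monoʳ-≤ n (<⇒≤ d<d′)) (≤-trans (+-monoʳ-≤ n (≤-trans (m≤n+m _ (toℕ x)) (≤-reflexive q)))
        (≤-reflexive (trans (+-comm n (toℕ z)) (sym p)))))))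
  ... | inj₂ p | inj₂ q = inj₂ (inj₂ (wraps {d = dist x z} q , x<y (trans q (sym p))))
    where
    x<y : toℕ x + toℕ (dist x z) ≡ toℕ y + toℕ (dist y z) → toℕ x < toℕ y
    x<y eq = +-cancelʳ-< (toℕ (dist y z)) _ _
      (subst (toℕ x + toℕ (dist y z) <_) eq (+-monoʳ-< (toℕ x) d<d′))

-- Counting in the digraph

ind-∧ : ∀ b c → ind (b ∧ c) ≤ ind c
ind-∧ true  c = ≤-refl
ind-∧ false c = z≤n

ind*≤ : ∀ b m → ind b * m ≤ m
ind*≤ true  m = ≤-reflexive (*-identityˡ m)
ind*≤ false m = z≤n

clockwise-rotate : ∀ {a b c} → ClockwiseOrder a b c → ClockwiseOrder b c a
clockwise-rotate (inj₁ p)        = inj₂ (inj₂ p)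
clockwise-rotate (inj₂ (inj₁ p)) = inj₁ p
clockwise-rotate (inj₂ (inj₂ p)) = inj₂ (inj₁ p)

<ᵇ-true : ∀ {m n} → (m <ᵇ n) ≡ true → m < n
<ᵇ-true {m} {n} eq = <ᵇ⇒< m n (subst T (sym eq) tt)

∑₂ : ∀ {m n} → (Fin m → Fin n → ℕ) → ℕ
∑₂ f = ∑ (λ i → ∑ (f i))

∑₂-mono : ∀ {m n} {f g : Fin m → Fin n → ℕ} → (∀ i j → f i j ≤ g i j) → ∑₂ f ≤ ∑₂ g
∑₂-mono f≤g = ∑-mono (λ i → ∑-mono (f≤g i))

∑₂-+ : ∀ {m n} (f g : Fin m → Fin n → ℕ) → ∑₂ (λ i j → f i j + g i j) ≡ ∑₂ f + ∑₂ g
∑₂-+ f g = trans (sum-cong-≗ (λ i → ∑-distrib-+ (f i) (g i)))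
                 (∑-distrib-+ (λ i → ∑ (f i)) (λ i → ∑ (g i)))

∑-linear : ∀ {n} c (f g : Fin n → ℕ) → ∑ (λ i → c * f i + g i) ≡ c * ∑ f + ∑ g
∑-linear c f g = trans (∑-distrib-+ (λ i → c * f i) g) (cong (_+ ∑ g) (sym (*-distribˡ-sum c f)))

-- Neighbourhoods as arcs of the circle

module Arrangement {n} (G : Digraph n) (two-free : TwoFree G)
  (pos : Permutation′ n) (arranged : IsCircularIntervalArrangement G pos) where

  e : Fin n → Fin n → ℕ
  e u w = ind (edge G u w)

  outdeg indeg : Fin n → ℕ
  outdeg u = ∑ (λ w → e u w)
  indeg  w = ∑ (λ u → e u w)

  ℓ : Fin n → Fin n → ℕ
  ℓ u w = toℕ (dist (pos ⟨$⟩ʳ u) (pos ⟨$⟩ʳ w))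

  ℓ-refl : ∀ u → ℓ u u ≡ 0
  ℓ-refl u = dist-refl (pos ⟨$⟩ʳ u)

  ℓ≡0⇒≡ : ∀ u w → ℓ u w ≡ 0 → u ≡ w
  ℓ≡0⇒≡ u w eq = trans (sym (inverseˡ pos)) (trans
    (cong (pos ⟨$⟩ˡ_) (dist≡0⇒≡ (pos ⟨$⟩ʳ u) (pos ⟨$⟩ʳ w) eq)) (inverseˡ pos))

  ℓ>0⇒≢ : ∀ {u w} → 0 < ℓ u w → u ≢ w
  ℓ>0⇒≢ {u} 0<ℓ refl = <⇒≢ 0<ℓ (sym (ℓ-refl u))

  loopless : ∀ {u} → ¬ (u ⇒[ G ] u)
  loopless {u} u⇒u with trans (sym u⇒u) (noLoop G u)
  ... | ()

  asymmetric : ∀ {u w} → u ⇒[ G ] w → ¬ (w ⇒[ G ] u)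
  asymmetric {u} {w} u⇒w w⇒u with u ≟ w
  ... | yes refl = loopless u⇒w
  ... | no u≢w   = two-free u w u≢w (u⇒w , w⇒u)

  through-from : ∀ {u v w} → 0 < ℓ u v → ℓ u v < ℓ u w → u ⇒[ G ] w → u ⇒[ G ] v × v ⇒[ G ] w
  through-from {u} {v} {w} 0<ℓ ℓ<ℓ = arranged u v w (ℓ>0⇒≢ 0<ℓ) (λ { refl → <-irrefl refl ℓ<ℓ })
    (ℓ>0⇒≢ (<-trans 0<ℓ ℓ<ℓ)) (dist-order-from 0<ℓ ℓ<ℓ)

  through-to : ∀ {u v w} → 0 < ℓ v w → ℓ v w < ℓ u w → u ⇒[ G ] w → u ⇒[ G ] v × v ⇒[ G ] w
  through-to {u} {v} {w} 0<ℓ ℓ<ℓ = arranged u v w (λ { refl → <-irrefl refl ℓ<ℓ }) (ℓ>0⇒≢ 0<ℓ)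
    (ℓ>0⇒≢ (<-trans 0<ℓ ℓ<ℓ)) (dist-order-to 0<ℓ ℓ<ℓ)

  -- The out-neighbours of `u` are the vertices right after it on the circle, because an edge from
  -- `u` yields edges to everything it passes over. So the out-edges have lengths 1, ...,
  -- `outdeg u`.
  out-sum : ∀ (g : ℕ → ℕ) u → ∑ (λ w → e u w * g (ℓ u w)) ≡ ∑ {outdeg u} (g ∘ suc ∘ toℕ)
  out-sum g u = ∑-initial-permuted (pos ∘ₚ distances-from (pos ⟨$⟩ʳ u)) (edge G u) g
    (λ w ℓ≡0 → trans (cong (edge G u) (sym (ℓ≡0⇒≡ u w ℓ≡0))) (noLoop G u))
    (λ v w 0<ℓ ℓ<ℓ u⇒w → proj₁ (through-from 0<ℓ ℓ<ℓ u⇒w))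

  in-sum : ∀ (g : ℕ → ℕ) w → ∑ (λ u → e u w * g (ℓ u w)) ≡ ∑ {indeg w} (g ∘ suc ∘ toℕ)
  in-sum g w = ∑-initial-permuted (pos ∘ₚ distances-to (pos ⟨$⟩ʳ w)) (λ u → edge G u w) g
    (λ u ℓ≡0 → trans (cong (λ v → edge G v w) (ℓ≡0⇒≡ u w ℓ≡0)) (noLoop G w))
    (λ v u 0<ℓ ℓ<ℓ u⇒w → proj₂ (through-to 0<ℓ ℓ<ℓ u⇒w))

  -- 2-freeness keeps the out-neighbours of w and the in-neighbours of u off the arc
  -- from u to w.
  arc-avoids : ∀ {u v w} → u ⇒[ G ] w → ℓ u v ≤ ℓ u w → ¬ (w ⇒[ G ] v) × ¬ (v ⇒[ G ] u)
  arc-avoids {u} {v} {w} u⇒w ℓ≤ℓ with u ≟ v | v ≟ w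
  ... | yes refl | _        = asymmetric u⇒w , loopless
  ... | no _     | yes refl = loopless , asymmetric u⇒w
  ... | no u≢v   | no v≢w   =
    -- An edge from `w` to `v` passes over `u`, and one from `v` to `u` passes over `w`; either way
    -- `w → u` follows, against 2-freeness.
    (λ w⇒v → asymmetric u⇒w (proj₁ (arranged w u v (u≢w ∘ sym) u≢v (v≢w ∘ sym) wuv w⇒v))) ,
    (λ v⇒u → asymmetric u⇒w (proj₂ (arranged v w u v≢w (u≢w ∘ sym) (u≢v ∘ sym) vwu v⇒u)))
    where
    u≢w : u ≢ w
    u≢w refl = loopless u⇒w
    ℓ≢ℓ : ℓ u v ≢ ℓ u w
    ℓ≢ℓ eq = v≢w (trans (sym (inverseˡ π)) (trans (cong (π ⟨$⟩ˡ_)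
        (toℕ-injective eq)) (inverseˡ π)))
      where π = pos ∘ₚ distances-from (pos ⟨$⟩ʳ u)
    vwu : ClockwiseOrder (toℕ (pos ⟨$⟩ʳ v)) (toℕ (pos ⟨$⟩ʳ w)) (toℕ (pos ⟨$⟩ʳ u))
    vwu = clockwise-rotate (dist-order-from (n≢0⇒n>0 (u≢v ∘ ℓ≡0⇒≡ u v)) (≤∧≢⇒< ℓ≤ℓ ℓ≢ℓ))
    wuv : ClockwiseOrder (toℕ (pos ⟨$⟩ʳ w)) (toℕ (pos ⟨$⟩ʳ u)) (toℕ (pos ⟨$⟩ʳ v))
    wuv = clockwise-rotate vwu

  -- Triangles and two-edge walks

  cyclic : Fin n → Fin n → ℕ
  cyclic u w = ∑ (λ v → e w v * e v u)

  -- Add up the sizes of three sets: the out-neighbours of `w`, the in-neighbours of `u` and the arc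
  -- from `u` to `w`. By `arc-avoids` the arc is disjoint from the other two, so a vertex is counted
  -- at most once, or twice if it closes a cyclic triangle.
  cyclic-lower : ∀ u w → u ⇒[ G ] w → outdeg w + indeg u + suc (ℓ u w) ≤ n + cyclic u w
  cyclic-lower u w u⇒w = begin
    outdeg w + indeg u + suc (ℓ u w)
      ≡⟨ cong₂ _+_ (sym (∑-distrib-+ (e w) (λ v → e v u))) (sym arc) ⟩
    ∑ (λ v → e w v + e v u) + ∑ (λ v → ind (ℓ u v <ᵇ suc (ℓ u w)))
      ≡⟨ ∑-distrib-+ (λ v → e w v + e v u) _ ⟨
    ∑ (λ v → e w v + e v u + ind (ℓ u v <ᵇ suc (ℓ u w)))
      ≤⟨ ∑-mono pointwise ⟩
    ∑ (λ v → 1 + e w v * e v u)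
      ≡⟨ ∑-distrib-+ {n} (λ _ → 1) _ ⟩
    ∑ {n} (λ _ → 1) + cyclic u w
      ≡⟨ cong (_+ cyclic u w) (trans (∑-const n 1) (*-identityʳ n)) ⟩
    n + cyclic u w ∎
    where
    open ≤-Reasoning
    -- Both endpoints belong to the arc, at distances 0 and `ℓ u w`; hence the `suc`.
    arc : ∑ (λ v → ind (ℓ u v <ᵇ suc (ℓ u w))) ≡ suc (ℓ u w)
    arc = trans (∑-permuted (pos ∘ₚ distances-from (pos ⟨$⟩ʳ u)) (λ d → ind (toℕ d <ᵇ suc (ℓ u w))))
                (∑-below _ (toℕ<n (dist (pos ⟨$⟩ʳ u) (pos ⟨$⟩ʳ w))))
    pointwise : ∀ v → e w v + e v u + ind (ℓ u v <ᵇ suc (ℓ u w)) ≤ 1 + e w v * e v u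
    pointwise v with ℓ u v <ᵇ suc (ℓ u w) in near | edge G w v in wv | edge G v u in vu
    ... | true  | true  | _     = ⊥-elim (proj₁ (arc-avoids u⇒w (s≤s⁻¹ (<ᵇ-true near))) wv)
    ... | true  | false | true  = ⊥-elim (proj₂ (arc-avoids u⇒w (s≤s⁻¹ (<ᵇ-true near))) vu)
    ... | true  | false | false = ≤-refl
    ... | false | true  | true  = ≤-refl
    ... | false | true  | false = ≤-refl
    ... | false | false | true  = ≤-refl
    ... | false | false | false = z≤n

  -- `transitives` counts each transitive triangle once, with `w` its middle vertex, while `cyclics`
  -- counts each cyclic triangle three times, once per edge. `walks` groups the walks of two edges
  -- by their middle vertex.
  paths transitives cyclics walks edges lengths : ℕ
  paths       = ∑₂ (λ u w → ∑ (λ v → ind (isInducedP3 G u w v)))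
  transitives = ∑₂ (λ u w → ∑ (λ v → e u w * (e w v * e u v)))
  cyclics     = ∑₂ (λ u w → e u w * cyclic u w)
  walks       = ∑ (λ w → indeg w * outdeg w)
  edges       = ∑₂ e

  count≡paths : inducedP3Count G ≡ paths
  count≡paths = trans (sum-map-allFin n (λ u → sumᴸ (map (λ w → sumᴸ (map (p₃ u w) (allFin n))) (allFin n))))
    (sum-cong-≗ (λ u → trans (sum-map-allFin n (λ w → sumᴸ (map (p₃ u w) (allFin n))))
      (sum-cong-≗ (λ w → sum-map-allFin n (p₃ u w)))))
    where
    p₃ : Fin n → Fin n → Fin n → ℕ
    p₃ u w v = ind (isInducedP3 G u w v)

  -- A walk `u → w → v` is at most one of: induced, closed by `u → v`, closed by `v → u`. The last
  -- two exclude each other by 2-freeness.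
  paths+triangles≤walks : paths + transitives + cyclics ≤ walks
  paths+triangles≤walks = begin
    paths + transitives + cyclics
      ≡⟨ cong (_+ cyclics) (∑₂-+ p t) ⟨
    ∑₂ (λ u w → p u w + t u w) + cyclics
      ≡⟨ ∑₂-+ (λ u w → p u w + t u w) _ ⟨
    ∑₂ (λ u w → p u w + t u w + e u w * cyclic u w)
      ≤⟨ ∑₂-mono bound ⟩
    ∑₂ (λ u w → e u w * outdeg w)
      ≡⟨ ∑-comm (λ u w → e u w * outdeg w) ⟩
    ∑ (λ w → ∑ (λ u → e u w * outdeg w))
      ≡⟨ sum-cong-≗ (λ w → sym (*-distribʳ-sum (outdeg w) (λ u → e u w))) ⟩
    walks ∎
    where
    open ≤-Reasoning
    p t : Fin n → Fin n → ℕ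
    p u w = ∑ (λ v → ind (isInducedP3 G u w v))
    t u w = ∑ (λ v → e u w * (e w v * e u v))
    core : ∀ u w v → ind (edge G u w ∧ edge G w v ∧ not (edge G u v) ∧ not (edge G v u))
      + e u w * (e w v * e u v) + e u w * (e w v * e v u) ≤ e u w * e w v
    core u w v with edge G u w | edge G w v | edge G u v in uv | edge G v u in vu
    ... | false | _     | _     | _     = z≤n
    ... | true  | false | _     | _     = z≤n
    ... | true  | true  | false | false = ≤-refl
    ... | true  | true  | false | true  = ≤-refl
    ... | true  | true  | true  | false = ≤-refl
    ... | true  | true  | true  | true  = ⊥-elim (asymmetric uv vu)
    pointwise : ∀ u w v → ind (isInducedP3 G u w v) + e u w * (e w v * e u v)
      + e u w * (e w v * e v u) ≤ e u w * e w v
    pointwise u w v = ≤-trans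
      (+-monoˡ-≤ (e u w * (e w v * e v u)) (+-monoˡ-≤ (e u w * (e w v * e u v))
        (≤-trans (ind-∧ (not (eqb u w)) _) (≤-trans (ind-∧ (not (eqb w v)) _) (ind-∧ (not (eqb u v)) _)))))
      (core u w v)
    bound : ∀ u w → p u w + t u w + e u w * cyclic u w ≤ e u w * outdeg w
    bound u w = begin
      p u w + t u w + e u w * cyclic u w
        ≡⟨ cong₂ _+_ (sym (∑-distrib-+ (λ v → ind (isInducedP3 G u w v)) _))
             (*-distribˡ-sum (e u w) (λ v → e w v * e v u)) ⟩
      ∑ (λ v → ind (isInducedP3 G u w v) + e u w * (e w v * e u v)) + ∑ (λ v → e u w * (e w v * e v u))
        ≡⟨ ∑-distrib-+ (λ v → ind (isInducedP3 G u w v) + e u w * (e w v * e u v)) _ ⟨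
      ∑ (λ v → ind (isInducedP3 G u w v) + e u w * (e w v * e u v) + e u w * (e w v * e v u))
        ≤⟨ ∑-mono (pointwise u w) ⟩
      ∑ (λ v → e u w * e w v)
        ≡⟨ *-distribˡ-sum (e u w) (e w) ⟨
      e u w * outdeg w ∎

  -- Edges longer than a threshold

  long : ℕ → Fin n → Fin n → ℕ
  long t u w = e u w * ind (t <ᵇ ℓ u w)

  long-length : ℕ → Fin n → Fin n → ℕ
  long-length t u w = e u w * (ind (t <ᵇ ℓ u w) * ℓ u w)

  -- Threshold 0 keeps every edge, as edges have positive length; the total length thus becomes an
  -- instance of the sums over long edges.
  lengths = ∑₂ (long-length 0)

  -- An edge `u → v` of length `ℓ u v` passes over `ℓ u v − 1` vertices, and each is the middle
  -- vertex of a transitive triangle on that edge.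
  lengths≤edges+transitives : lengths ≤ edges + transitives
  lengths≤edges+transitives = begin
    lengths                                                 ≤⟨ ∑₂-mono bound ⟩
    ∑₂ (λ u v → e u v + ∑ (λ w → e u w * (e w v * e u v)))  ≡⟨ ∑₂-+ e _ ⟩
    edges + ∑₂ (λ u v → ∑ (λ w → e u w * (e w v * e u v)))
      ≡⟨ cong (edges +_) (sum-cong-≗ (λ u → ∑-comm (λ v w → e u w * (e w v * e u v)))) ⟩
    edges + transitives ∎
    where
    open ≤-Reasoning
    bound : ∀ u v → long-length 0 u v ≤ e u v + ∑ (λ w → e u w * (e w v * e u v))
    bound u v with edge G u v in u⇒v
    ... | false = z≤n
    ... | true  = begin
      1 * (ind (0 <ᵇ ℓ u v) * ℓ u v)
        ≡⟨ *-identityˡ _ ⟩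
      ind (0 <ᵇ ℓ u v) * ℓ u v
        ≤⟨ ind*≤ (0 <ᵇ ℓ u v) (ℓ u v) ⟩
      ℓ u v
        ≤⟨ ∑-strictly-between (ℓ u v) (<⇒≤ (toℕ<n (dist (pos ⟨$⟩ʳ u) (pos ⟨$⟩ʳ v)))) ⟩
      suc (∑ {n} (λ d → ind (0 <ᵇ toℕ d) * ind (toℕ d <ᵇ ℓ u v)))
        ≡⟨ cong suc (∑-permuted (pos ∘ₚ distances-from (pos ⟨$⟩ʳ u))
             (λ d → ind (0 <ᵇ toℕ d) * ind (toℕ d <ᵇ ℓ u v))) ⟨
      suc (∑ (λ w → ind (0 <ᵇ ℓ u w) * ind (ℓ u w <ᵇ ℓ u v)))
        ≤⟨ s≤s (∑-mono pointwise) ⟩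
      suc (∑ (λ w → e u w * (e w v * 1))) ∎
      where
      pointwise : ∀ w → ind (0 <ᵇ ℓ u w) * ind (ℓ u w <ᵇ ℓ u v) ≤ e u w * (e w v * 1)
      pointwise w with 0 <ᵇ ℓ u w in 0<ℓ | ℓ u w <ᵇ ℓ u v in ℓ<ℓ
      ... | false | _     = z≤n
      ... | true  | false = z≤n
      ... | true  | true  with through-from (<ᵇ-true 0<ℓ) (<ᵇ-true ℓ<ℓ) u⇒v
      ...   | u⇒w , w⇒v rewrite u⇒w | w⇒v = ≤-refl

  long-out : ∀ t u → ∑ (long t u) ≡ outdeg u ∸ t
  long-out t u = trans (out-sum (λ k → ind (t <ᵇ k)) u) (∑-above t (outdeg u))

  long-in : ∀ t w → ∑ (λ u → long t u w) ≡ indeg w ∸ t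
  long-in t w = trans (in-sum (λ k → ind (t <ᵇ k)) w) (∑-above t (indeg w))

  long-length-out : ∀ t u → 2 * ∑ (long-length t u) ≡ (outdeg u ∸ t) * suc (outdeg u + t)
  long-length-out t u = trans (cong (2 *_) (out-sum (λ k → ind (t <ᵇ k) * k) u)) (∑-above-lengths t (outdeg u))

  long-length-in : ∀ t w → 2 * ∑ (λ u → long-length t u w) ≡ (indeg w ∸ t) * suc (indeg w + t)
  long-length-in t w = trans (cong (2 *_) (in-sum (λ k → ind (t <ᵇ k) * k) w)) (∑-above-lengths t (indeg w))

  module _ (t : ℕ) where

    longEdges longLengths : ℕ
    longEdges   = ∑₂ (long t)
    longLengths = ∑₂ (long-length t)

    longEdges-out : ∑ (λ u → outdeg u ∸ t) ≡ longEdges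
    longEdges-out = sym (sum-cong-≗ (long-out t))

    longEdges-in : ∑ (λ w → indeg w ∸ t) ≡ longEdges
    longEdges-in = trans (sym (sum-cong-≗ (long-in t))) (sym (∑-comm (long t)))

    longLengths-out : ∑ (λ u → (outdeg u ∸ t) * suc (outdeg u + t)) ≡ 2 * longLengths
    longLengths-out = trans (sym (sum-cong-≗ (long-length-out t)))
      (sym (*-distribˡ-sum 2 (λ u → ∑ (long-length t u))))

    longLengths-in : ∑ (λ w → (indeg w ∸ t) * suc (indeg w + t)) ≡ 2 * longLengths
    longLengths-in = trans (sym (sum-cong-≗ (long-length-in t)))
      (trans (sym (*-distribˡ-sum 2 (λ w → ∑ (λ u → long-length t u w))))
             (cong (2 *_) (sym (∑-comm (long-length t)))))

    -- Sums over the long edges `u → w` of `outdeg w`, grouped by head, and of `indeg u`, grouped by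
    -- tail.
    outOverLong inOverLong : ℕ
    outOverLong = ∑ (λ w → outdeg w * (indeg w ∸ t))
    inOverLong  = ∑ (λ u → indeg u * (outdeg u ∸ t))

    -- The sum of `cyclic-lower` over the long edges. Every other edge adds nothing on the left and
    -- a nonnegative term to `cyclics`.
    long≤cyclics : outOverLong + inOverLong + longLengths + longEdges ≤ n * longEdges + cyclics
    long≤cyclics = begin
      outOverLong + inOverLong + longLengths + longEdges
        ≡⟨ cong₂ (λ a b → a + b + longLengths + longEdges) out-part in-part ⟩
      ∑₂ (λ u w → outdeg w * long t u w) + ∑₂ (λ u w → indeg u * long t u w) + longLengths + longEdges
        ≡⟨ cong (λ s → s + longLengths + longEdges) (∑₂-+ (λ u w → outdeg w * long t u w) _) ⟨
      ∑₂ (λ u w → outdeg w * long t u w + indeg u * long t u w) + longLengths + longEdges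
        ≡⟨ cong (_+ longEdges) (∑₂-+ (λ u w → outdeg w * long t u w + indeg u * long t u w) _) ⟨
      ∑₂ (λ u w → outdeg w * long t u w + indeg u * long t u w + long-length t u w) + longEdges
        ≡⟨ ∑₂-+ (λ u w → outdeg w * long t u w + indeg u * long t u w + long-length t u w) _ ⟨
      ∑₂ (λ u w → outdeg w * long t u w + indeg u * long t u w + long-length t u w + long t u w)
        ≤⟨ ∑₂-mono bound ⟩
      ∑₂ (λ u w → n * long t u w + e u w * cyclic u w)
        ≡⟨ ∑₂-+ (λ u w → n * long t u w) _ ⟩
      ∑₂ (λ u w → n * long t u w) + cyclics
        ≡⟨ cong (_+ cyclics) (sum-cong-≗ (λ u → *-distribˡ-sum n (long t u))) ⟨
      ∑ (λ u → n * ∑ (long t u)) + cyclics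
        ≡⟨ cong (_+ cyclics) (*-distribˡ-sum n (λ u → ∑ (long t u))) ⟨
      n * longEdges + cyclics ∎
      where
      open ≤-Reasoning
      out-part : outOverLong ≡ ∑₂ (λ u w → outdeg w * long t u w)
      out-part = trans
        (sum-cong-≗ (λ w → trans (cong (outdeg w *_) (sym (long-in t w)))
                                 (*-distribˡ-sum (outdeg w) (λ u → long t u w))))
        (sym (∑-comm (λ u w → outdeg w * long t u w)))
      in-part : inOverLong ≡ ∑₂ (λ u w → indeg u * long t u w)
      in-part = sum-cong-≗ (λ u → trans (cong (indeg u *_) (sym (long-out t u)))
                                        (*-distribˡ-sum (indeg u) (long t u)))
      identity : ∀ a b l → a * 1 + b * 1 + 1 * (1 * l) + 1 ≡ a + b + suc l
      identity = solve-∀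
      identity₀ : ∀ a b → a * 0 + b * 0 + 0 + 0 ≡ 0
      identity₀ = solve-∀
      bound : ∀ u w → outdeg w * long t u w + indeg u * long t u w + long-length t u w + long t u w
        ≤ n * long t u w + e u w * cyclic u w
      bound u w with edge G u w in u⇒w | t <ᵇ ℓ u w
      ... | false | _     = ≤-trans (≤-reflexive (identity₀ (outdeg w) (indeg u))) z≤n
      ... | true  | false = ≤-trans (≤-reflexive (identity₀ (outdeg w) (indeg u))) z≤n
      ... | true  | true  = begin
        outdeg w * 1 + indeg u * 1 + 1 * (1 * ℓ u w) + 1  ≡⟨ identity (outdeg w) (indeg u) (ℓ u w) ⟩
        outdeg w + indeg u + suc (ℓ u w)                  ≤⟨ cyclic-lower u w u⇒w ⟩
        n + cyclic u w      ≡⟨ cong₂ _+_ (*-identityʳ n) (*-identityˡ (cyclic u w)) ⟨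
        n * 1 + 1 * cyclic u w ∎

  -- Summation over the vertices

  edges-in : ∑ indeg ≡ edges
  edges-in = sym (∑-comm e)

  lengths-out : ∑ (λ u → outdeg u * suc (outdeg u)) ≡ 2 * lengths
  lengths-out = trans (sum-cong-≗ (λ u → cong (λ d → outdeg u * suc d) (sym (+-identityʳ (outdeg u)))))
    (longLengths-out 0)

  lengths-in : ∑ (λ u → indeg u * suc (indeg u)) ≡ 2 * lengths
  lengths-in = trans (sum-cong-≗ (λ u → cong (λ d → indeg u * suc d) (sym (+-identityʳ (indeg u)))))
    (longLengths-in 0)

  -- `gain` and `loss` are nested to the right, so this peels off their terms one at a time.
  ∑-step : ∀ c {p q} (f : Fin n → ℕ) {g} → ∑ f ≡ p → ∑ g ≡ q → ∑ (λ v → c * f v + g v) ≡ c * p + q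
  ∑-step c f {g} ∑f ∑g = trans (∑-linear c f g) (cong₂ (λ p q → c * p + q) ∑f ∑g)

  ∑-scale : ∀ c {p} (f : Fin n → ℕ) → ∑ f ≡ p → ∑ (λ v → c * f v) ≡ c * p
  ∑-scale c f ∑f = trans (sym (*-distribˡ-sum c f)) (cong (c *_) ∑f)

  module _ (t : ℕ) where

    private
      x y : Fin n → ℕ
      x v = indeg v ∸ t
      y v = outdeg v ∸ t

    -- Edges and long edges are counted half from their heads and half from their tails, which makes
    -- the vertex function symmetric in the two degrees. The lengths in `∑-loss` are split likewise.
    ∑-gain : ∑ (λ v → gain n (indeg v) (outdeg v) (x v) (y v))
      ≡ 16 * walks + (8 * edges + (8 * edges + (8 * n * longEdges t + 8 * n * longEdges t)))
    ∑-gain =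
      ∑-step 16 (λ v → indeg v * outdeg v) refl (
      ∑-step 8 indeg edges-in (
      ∑-step 8 outdeg refl (
      ∑-step (8 * n) x (longEdges-in t) (
      ∑-scale (8 * n) y (longEdges-out t)))))

    ∑-loss : ∑ (λ v → n * n + loss t (indeg v) (outdeg v) (x v) (y v))
      ≡ n * (n * n) + (4 * (2 * lengths) + (4 * (2 * lengths) + (16 * outOverLong t + (16 * inOverLong t +
        (4 * (2 * longLengths t) + (4 * (2 * longLengths t) + (8 * longEdges t + 8 * longEdges t)))))))
    ∑-loss = trans (∑-distrib-+ {n} (λ _ → n * n) _) (cong₂ _+_ (∑-const n (n * n)) (
      ∑-step 4 (λ v → indeg v * suc (indeg v)) lengths-in (
      ∑-step 4 (λ v → outdeg v * suc (outdeg v)) lengths-out (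
      ∑-step 16 (λ v → outdeg v * x v) refl (
      ∑-step 16 (λ v → indeg v * y v) refl (
      ∑-step 4 (λ v → x v * suc (indeg v + t)) (longLengths-in t) (
      ∑-step 4 (λ v → y v * suc (outdeg v + t)) (longLengths-out t) (
      ∑-step 8 x (longEdges-in t) (
      ∑-scale 8 y (longEdges-out t))))))))))

  paths-bound : 16 * paths ≤ n ^ 3
  -- The cancelled term collects what the three counting inequalities would otherwise subtract:
  -- triangles, edges, and `n` times the number of long edges.
  paths-bound = +-cancelʳ-≤ (16 * (transitives + cyclics + edges + n * yₜ)) (16 * paths) (n ^ 3) (begin
    16 * paths + 16 * (transitives + cyclics + edges + n * yₜ)
      ≡⟨ identity₁ paths transitives cyclics edges n yₜ ⟩
    16 * (paths + transitives + cyclics) + (16 * edges + 16 * (n * yₜ))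
      ≤⟨ +-monoˡ-≤ (16 * edges + 16 * (n * yₜ)) (*-monoʳ-≤ 16 paths+triangles≤walks) ⟩
    16 * walks + (16 * edges + 16 * (n * yₜ))
      ≡⟨ identity₂ walks edges n yₜ ⟩
    16 * walks + (8 * edges + (8 * edges + (8 * n * yₜ + 8 * n * yₜ)))
      ≡⟨ ∑-gain t ⟨
    ∑ (λ v → gain n (indeg v) (outdeg v) (indeg v ∸ t) (outdeg v ∸ t))
      ≤⟨ ∑-mono (λ v → gain≤loss n (indeg v) (outdeg v)) ⟩
    ∑ (λ v → n * n + loss t (indeg v) (outdeg v) (indeg v ∸ t) (outdeg v ∸ t))
      ≡⟨ ∑-loss t ⟩
    n * (n * n) + (4 * (2 * lengths) + (4 * (2 * lengths) + (16 * outOverLong t + (16 * inOverLong t +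
      (4 * (2 * longLengths t) + (4 * (2 * longLengths t) + (8 * yₜ + 8 * yₜ)))))))
      ≡⟨ identity₃ n lengths (outOverLong t) (inOverLong t) (longLengths t) yₜ ⟩
    n ^ 3 + (16 * lengths + 16 * (outOverLong t + inOverLong t + longLengths t + yₜ))
      ≤⟨ +-monoʳ-≤ (n ^ 3) (+-mono-≤ (*-monoʳ-≤ 16 lengths≤edges+transitives) (*-monoʳ-≤ 16 (long≤cyclics t))) ⟩
    n ^ 3 + (16 * (edges + transitives) + 16 * (n * yₜ + cyclics))
      ≡⟨ cong (n ^ 3 +_) (identity₄ transitives cyclics edges (n * yₜ)) ⟩
    n ^ 3 + 16 * (transitives + cyclics + edges + n * yₜ) ∎)
    where
    open ≤-Reasoning
    t = n / 4
    yₜ = longEdges t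
    identity₁ : ∀ p r c m n y → 16 * p + 16 * (r + c + m + n * y)
      ≡ 16 * (p + r + c) + (16 * m + 16 * (n * y))
    identity₁ = solve-∀
    identity₂ : ∀ s m n y → 16 * s + (16 * m + 16 * (n * y))
      ≡ 16 * s + (8 * m + (8 * m + (8 * n * y + 8 * n * y)))
    identity₂ = solve-∀
    identity₃ : ∀ n l z z′ x y → n * (n * n) + (4 * (2 * l) + (4 * (2 * l) + (16 * z + (16 * z′ +
      (4 * (2 * x) + (4 * (2 * x) + (8 * y + 8 * y)))))))
      ≡ n * (n * (n * 1)) + (16 * l + 16 * (z + z′ + x + y))
    identity₃ = solve-∀
    identity₄ : ∀ r c m k → 16 * (m + r) + 16 * (k + c) ≡ 16 * (r + c + m + k)
    identity₄ = solve-∀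

theorem3p1 : ∀ (n : ℕ) (G : Digraph n) → TwoFree G → CircularInterval G →
    16 * inducedP3Count G ≤ n ^ 3
theorem3p1 n G two-free (pos , arranged) =
  subst (λ p → 16 * p ≤ n ^ 3) (sym count≡paths) paths-bound
  where open Arrangement G two-free pos arranged
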